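{- Let $\alpha$ be a real number. For every real number $N \ge 1$ there exists $p/q \in \mathbb{Q}(\mathbf{H}_4)$ (in normalized form) such that $$\left| q\alpha - p \right| < \frac{\sqrt 2 + 1}{2}\cdot\frac{1}{N} \quad\text{ with }\quad 1 \le q \le N.$$
   Context: The Hecke group $\mathbf{H}_4$ is the subgroup of $\mathrm{PSL}_2(\mathbb{R})$ generated by $\begin{pmatrix}1&\sqrt2\\0&1\end{pmatrix}$ and $\begin{pmatrix}0&-1\\1&0\end{pmatrix}$. The set $\mathbb{Q}(\mathbf{H}_4)\subset \mathbb{R}\cup\{\infty\}$ is the set of all $p/q$ such that $\begin{pmatrix} p & r \\ q & s \end{pmatrix}\in\mathbf{H}_4$ for some $r,s$; its finite elements form the set $\sqrt2\,\mathbb{Q}$. Writing $p/q\in\mathbb{Q}(\mathbf{H}_4)$ always means the normalized form: $(p,q)$ is the first column of a matrix in $\mathbf{H}_4$ with $q>0$. Explicitly, either $p=a$, $q=\sqrt2\,c$ with $a,c\in\mathbb{Z}$, $c>0$, $\gcd(a,2c)=1$, or $p=\sqrt2\,a$, $q=c$ with $a,c\in\mathbb{Z}$, $c>0$, $\gcd(2a,c)=1$. -}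

module Defs where

open import Algebra.Bundles using (CommutativeRing; Group)
open import Algebra.Structures using (IsCommutativeRing)
open import Data.Product using (_×_; _,_; proj₁; proj₂; ∃; ∃-syntax)
open import Data.Sum using (_⊎_; inj₁; inj₂)
open import Level using (Level; _⊔_; suc)
open import Relation.Binary.Core using (Rel)
open import Relation.Binary.Definitions using (Tri; tri<; tri≈; tri>)
open import Relation.Binary.Structures using (IsStrictTotalOrder)
import Relation.Binary.Construct.StrictToNonStrict as ToNonStrict
import Relation.Binary.Reasoning.Setoid as SetoidReasoning
open import Relation.Nullary.Negation using (¬_; contradiction)
open import Relation.Unary using (Pred; _∈_)

-- The real numbers, characterised (uniquely up to isomorphism) as the
-- Dedekind-complete ordered field of classical analysis.  The supremum is
-- given in its positive form: whatever lies strictly below it is exceeded by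
-- an element of the set.  Since predicates are arbitrary and the order is
-- decidable, this entails excluded middle at level c ⊔ ℓ (take the supremum
-- of { 0 } ∪ { 1 ∣ A }), so no separate classical axiom has to be assumed.
-- As usual in total-inverse presentations, nothing is assumed about 0# ⁻¹.

record CompleteOrderedField (c ℓ : Level) : Set (suc (c ⊔ ℓ)) where
  infix  8 _⁻¹
  infix  8 -_
  infixl 7 _*_
  infixl 6 _+_
  infix  4 _≈_ _<_
  field
    Carrier            : Set c
    _≈_                : Rel Carrier ℓ
    _<_                : Rel Carrier ℓ
    _+_                : Carrier → Carrier → Carrier
    _*_                : Carrier → Carrier → Carrier
    -_                 : Carrier → Carrier
    _⁻¹                : Carrier → Carrier
    0#                 : Carrier
    1#                 : Carrier
    isCommutativeRing  : IsCommutativeRing _≈_ _+_ _*_ -_ 0# 1#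
    1≉0                : ¬ (1# ≈ 0#)
    *-inverseʳ         : ∀ x → ¬ (x ≈ 0#) → x * x ⁻¹ ≈ 1#
    isStrictTotalOrder : IsStrictTotalOrder _≈_ _<_
    +-monoˡ-<          : ∀ z {x y} → x < y → x + z < y + z
    *-pos              : ∀ {x y} → 0# < x → 0# < y → 0# < x * y

  commutativeRing : CommutativeRing c ℓ
  commutativeRing = record { isCommutativeRing = isCommutativeRing }

  open CommutativeRing commutativeRing public
    using (setoid; commutativeSemiring; ring; _-_)

  open ToNonStrict _≈_ _<_ public using (_≤_)

  field
    supremum : (P : Pred Carrier (c ⊔ ℓ)) →
               ∃[ x ] x ∈ P →
               ∃[ b ] (∀ x → x ∈ P → x ≤ b) →
               ∃[ s ] (∀ x → x ∈ P → x ≤ s)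
                    × (∀ y → y < s → ∃[ x ] x ∈ P × y < x)

data ⟨_∣_⟩ {c ℓ g} (G : Group c ℓ) (S : Pred (Group.Carrier G) g) :
           Pred (Group.Carrier G) (c ⊔ ℓ ⊔ g) where
  gen  : ∀ {x} → x ∈ S → x ∈ ⟨ G ∣ S ⟩
  unit : Group.ε G ∈ ⟨ G ∣ S ⟩
  mul  : ∀ {x y} → x ∈ ⟨ G ∣ S ⟩ → y ∈ ⟨ G ∣ S ⟩ → Group._∙_ G x y ∈ ⟨ G ∣ S ⟩
  inv  : ∀ {x} → x ∈ ⟨ G ∣ S ⟩ → Group._⁻¹ G x ∈ ⟨ G ∣ S ⟩
  resp : ∀ {x y} → Group._≈_ G x y → x ∈ ⟨ G ∣ S ⟩ → y ∈ ⟨ G ∣ S ⟩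

module Hecke {κ ℓ} (ℝ : CompleteOrderedField κ ℓ) where

  open CompleteOrderedField ℝ
  open CommutativeRing commutativeRing
    using ( refl; sym; trans; +-cong; *-cong; -‿cong; +-assoc; +-comm
          ; +-identityˡ; +-identityʳ; -‿inverseʳ; -‿inverseˡ; *-comm; *-assoc
          ; *-identityˡ; *-identityʳ; zeroˡ; zeroʳ; distribʳ)
  open IsStrictTotalOrder isStrictTotalOrder
    using (compare; irrefl)
    renaming (trans to <-trans; <-respʳ-≈ to <-respʳ; <-respˡ-≈ to <-respˡ)
  open import Algebra.Properties.Ring ring
    using (-‿distribˡ-*; -‿distribʳ-*; -‿involutive; -‿+-comm; -0#≈0#)
  open import Algebra.Solver.Ring.NaturalCoefficients.Default commutativeSemiring
    using (solve; _:+_; _:*_; _:=_; con)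
  open SetoidReasoning setoid

  ∣_∣ : Carrier → Carrier
  ∣ x ∣ with compare x 0#
  ... | tri< _ _ _ = - x
  ... | tri≈ _ _ _ = x
  ... | tri> _ _ _ = x

  infixl 7 _/_
  _/_ : Carrier → Carrier → Carrier
  x / y = x * y ⁻¹

  2# : Carrier
  2# = 1# + 1#

  <-mono : ∀ {x y u v} → x < y → u < v → x + u < y + v
  <-mono {x} {y} {u} {v} x<y u<v =
    <-trans (+-monoˡ-< u x<y)
            (<-respˡ (+-comm u y) (<-respʳ (+-comm v y) (+-monoˡ-< y u<v)))

  +-pos : ∀ {x y} → 0# < x → 0# < y → 0# < x + y
  +-pos p q = <-respˡ (+-identityˡ 0#) (<-mono p q)

  sub-pos : ∀ {x y} → x < y → 0# < y - x
  sub-pos {x} p = <-respˡ (-‿inverseʳ x) (+-monoˡ-< (- x) p)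

  sub-add : ∀ x y → (y - x) + x ≈ y
  sub-add x y = trans (+-assoc y (- x) x)
               (trans (+-cong refl (-‿inverseˡ x)) (+-identityʳ y))

  *-mono : ∀ {x y z} → 0# < z → x < y → x * z < y * z
  *-mono {x} {y} {z} 0<z x<y =
    <-respˡ (+-identityˡ (x * z))
      (<-respʳ (trans (sym (distribʳ z (y - x) x)) (*-cong (sub-add x y) refl))
        (+-monoˡ-< (x * z) (*-pos (sub-pos x<y) 0<z)))

  *-cancel : ∀ {x y z} → 0# < z → x * z < y * z → x < y
  *-cancel {x} {y} {z} 0<z p with compare x y
  ... | tri< x<y _ _ = x<y
  ... | tri≈ _ x≈y _ = contradiction p (irrefl (*-cong x≈y refl))
  ... | tri> _ _ y<x = contradiction (<-trans p (*-mono 0<z y<x)) (irrefl refl)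

  0<1 : 0# < 1#
  0<1 with compare 0# 1#
  ... | tri< p _ _ = p
  ... | tri≈ _ e _ = contradiction (sym e) 1≉0
  ... | tri> _ _ n =
    <-respʳ (trans (sym (-‿distribˡ-* 1# (- 1#)))
              (trans (-‿cong (*-identityˡ (- 1#))) (-‿involutive 1#)))
            (*-pos -1>0 -1>0)
    where
    -1>0 : 0# < - 1#
    -1>0 = <-respʳ (+-identityˡ (- 1#)) (sub-pos n)

  0<2 : 0# < 2#
  0<2 = +-pos 0<1 0<1

  square-mono : ∀ {x y} → 0# < x → x < y → x * x < y * y
  square-mono {x} {y} 0<x x<y =
    <-trans (*-mono 0<x x<y)
            (<-respˡ (*-comm x y) (*-mono (<-trans 0<x x<y) x<y))

  1<2 : 1# < 2#
  1<2 = <-respˡ (+-identityˡ 1#) (+-monoˡ-< 1# 0<1)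

  private
    Below : Pred Carrier (κ ⊔ ℓ)
    Below x = Level.Lift κ (x * x < 2#)

    below-1 : 1# ∈ Below
    below-1 = Level.lift (<-respˡ (sym (*-identityˡ 1#)) 1<2)

    below-2 : ∀ x → x ∈ Below → x ≤ 2#
    below-2 x (Level.lift x²<2) with compare x 2#
    ... | tri< p _ _ = inj₁ p
    ... | tri≈ _ e _ = inj₂ e
    ... | tri> _ _ 2<x =
      contradiction
        (<-trans x²<2
          (<-trans (<-respˡ (*-identityˡ 2#) (*-mono 0<2 1<2)) (square-mono 0<2 2<x)))
        (irrefl refl)

    sup-Below : ∃[ s ] (∀ x → x ∈ Below → x ≤ s)
                     × (∀ y → y < s → ∃[ x ] x ∈ Below × y < x)
    sup-Below = supremum Below (1# , below-1) (2# , below-2)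

  -- For t = s + 2 the Newton-type step y = (2s + 2) / t satisfies
  -- y - s = (2 - s²) / t and y² - 2 = 2 (s² - 2) / t², which rules out
  -- s² < 2 and s² > 2 for the supremum s of { x ∣ x² < 2 }.

  √2-exists : ∃[ x ] 0# < x × x * x ≈ 2#
  √2-exists = s , 0<s , s²≈2
    where
    s  = proj₁ sup-Below
    ub = proj₁ (proj₂ sup-Below)
    ap = proj₂ (proj₂ sup-Below)

    0<s : 0# < s
    0<s with ub 1# below-1
    ... | inj₁ 1<s = <-trans 0<1 1<s
    ... | inj₂ 1≈s = <-respʳ 1≈s 0<1

    t m y : Carrier
    t = s + 2#
    m = s * 2# + 2#
    y = m * t ⁻¹

    0<t : 0# < t
    0<t = +-pos 0<s 0<2

    0<m : 0# < m
    0<m = +-pos (*-pos 0<s 0<2) 0<2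

    yt≈m : y * t ≈ m
    yt≈m = begin
      m * t ⁻¹ * t    ≈⟨ *-assoc m (t ⁻¹) t ⟩
      m * (t ⁻¹ * t)  ≈⟨ *-cong refl (*-comm (t ⁻¹) t) ⟩
      m * (t * t ⁻¹)  ≈⟨ *-cong refl (*-inverseʳ t (λ e → irrefl (sym e) 0<t)) ⟩
      m * 1#          ≈⟨ *-identityʳ m ⟩
      m               ∎

    0<y : 0# < y
    0<y = *-cancel 0<t (<-respˡ (sym (zeroˡ t)) (<-respʳ (sym yt≈m) 0<m))

    st≈ : s * t ≈ s * s + s * 2#
    st≈ = solve 1 (λ s → s :* (s :+ con 2) := s :* s :+ s :* con 2) refl s

    m≈ : m ≈ 2# + s * 2#
    m≈ = +-comm (s * 2#) 2#

    yytt≈ : y * y * (t * t) ≈ (s * s + s * s) + (s * s + s * s + s * 2# * 2# * 2# + 2# * 2#)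
    yytt≈ = begin
      y * y * (t * t)
        ≈⟨ solve 2 (λ y t → y :* y :* (t :* t) := y :* t :* (y :* t)) refl y t ⟩
      y * t * (y * t)
        ≈⟨ *-cong yt≈m yt≈m ⟩
      m * m
        ≈⟨ solve 1 (λ s → (s :* con 2 :+ con 2) :* (s :* con 2 :+ con 2)
             := (s :* s :+ s :* s) :+ (s :* s :+ s :* s :+ s :* con 2 :* con 2 :* con 2 :+ con 2 :* con 2)) refl s ⟩
      _ ∎

    2tt≈ : 2# * (t * t) ≈ (2# + 2#) + (s * s + s * s + s * 2# * 2# * 2# + 2# * 2#)
    2tt≈ = solve 1 (λ s → con 2 :* ((s :+ con 2) :* (s :+ con 2))
             := (con 2 :+ con 2) :+ (s :* s :+ s :* s :+ s :* con 2 :* con 2 :* con 2 :+ con 2 :* con 2)) refl s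

    s²≈2 : s * s ≈ 2#
    s²≈2 with compare (s * s) 2#
    ... | tri≈ _ e _ = e
    ... | tri< s²<2 _ _ = contradiction y≤s λ where
            (inj₁ y<s) → irrefl refl (<-trans s<y y<s)
            (inj₂ y≈s) → irrefl (sym y≈s) s<y
      where
      s<y : s < y
      s<y = *-cancel 0<t (<-respˡ (sym st≈) (<-respʳ (sym (trans yt≈m m≈)) (+-monoˡ-< _ s²<2)))
      y²<2 : y * y < 2#
      y²<2 = *-cancel (*-pos 0<t 0<t)
               (<-respˡ (sym yytt≈) (<-respʳ (sym 2tt≈) (+-monoˡ-< _ (<-mono s²<2 s²<2))))
      y≤s : y ≤ s
      y≤s = ub y (Level.lift y²<2)
    ... | tri> _ _ 2<s² with ap y y<s
      where
      y<s : y < s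
      y<s = *-cancel 0<t (<-respˡ (sym (trans yt≈m m≈)) (<-respʳ (sym st≈) (+-monoˡ-< _ 2<s²)))
    ...   | x , Level.lift x²<2 , y<x =
            contradiction (<-trans 2<y² (<-trans (square-mono 0<y y<x) x²<2)) (irrefl refl)
      where
      2<y² : 2# < y * y
      2<y² = *-cancel (*-pos 0<t 0<t)
               (<-respˡ (sym 2tt≈) (<-respʳ (sym yytt≈) (+-monoˡ-< _ (<-mono 2<s² 2<s²))))

  √2 : Carrier
  √2 = proj₁ √2-exists

  -- The matrix with rows (a b) and (c d).

  record Mat₂ : Set κ where
    constructor mat
    field a b c d : Carrier

  infix  4 _≈ₘ_ _≈±_
  infixl 7 _*ₘ_

  record _≈ₘ_ (A B : Mat₂) : Set ℓ where
    constructor mat≈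
    module A = Mat₂ A
    module B = Mat₂ B
    field
      a≈ : A.a ≈ B.a
      b≈ : A.b ≈ B.b
      c≈ : A.c ≈ B.c
      d≈ : A.d ≈ B.d

  _*ₘ_ : Mat₂ → Mat₂ → Mat₂
  mat a b c d *ₘ mat a′ b′ c′ d′ =
    mat (a * a′ + b * c′) (a * b′ + b * d′) (c * a′ + d * c′) (c * b′ + d * d′)

  -ₘ_ : Mat₂ → Mat₂
  -ₘ mat a b c d = mat (- a) (- b) (- c) (- d)

  Iₘ : Mat₂
  Iₘ = mat 1# 0# 0# 1#

  adj : Mat₂ → Mat₂
  adj (mat a b c d) = mat d (- b) (- c) a

  det : Mat₂ → Carrier
  det (mat a b c d) = a * d - b * c

  -- Elements of PSL₂(ℝ) are represented by matrices of determinant one,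
  -- with A and - A identified.

  record SL₂ : Set (κ ⊔ ℓ) where
    constructor sl
    field
      matrix : Mat₂
      det≈1  : det matrix ≈ 1#
    open Mat₂ matrix public

  _≈±_ : Rel Mat₂ ℓ
  A ≈± B = A ≈ₘ B ⊎ A ≈ₘ -ₘ B

  private
    ≈ₘ-refl : ∀ {A} → A ≈ₘ A
    ≈ₘ-refl = mat≈ refl refl refl refl

    ≈ₘ-sym : ∀ {A B} → A ≈ₘ B → B ≈ₘ A
    ≈ₘ-sym (mat≈ p q r s) = mat≈ (sym p) (sym q) (sym r) (sym s)

    ≈ₘ-trans : ∀ {A B C} → A ≈ₘ B → B ≈ₘ C → A ≈ₘ C
    ≈ₘ-trans (mat≈ p q r s) (mat≈ p′ q′ r′ s′) =
      mat≈ (trans p p′) (trans q q′) (trans r r′) (trans s s′)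

    -ₘ-cong : ∀ {A B} → A ≈ₘ B → -ₘ A ≈ₘ -ₘ B
    -ₘ-cong (mat≈ p q r s) = mat≈ (-‿cong p) (-‿cong q) (-‿cong r) (-‿cong s)

    -ₘ-involutive : ∀ A → -ₘ (-ₘ A) ≈ₘ A
    -ₘ-involutive (mat a b c d) =
      mat≈ (-‿involutive a) (-‿involutive b) (-‿involutive c) (-‿involutive d)

    *ₘ-cong : ∀ {A B C D} → A ≈ₘ B → C ≈ₘ D → A *ₘ C ≈ₘ B *ₘ D
    *ₘ-cong (mat≈ p q r s) (mat≈ p′ q′ r′ s′) = mat≈
      (+-cong (*-cong p p′) (*-cong q r′)) (+-cong (*-cong p q′) (*-cong q s′))
      (+-cong (*-cong r p′) (*-cong s r′)) (+-cong (*-cong r q′) (*-cong s s′))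

    negˡ : ∀ x y z w → - x * y + - z * w ≈ - (x * y + z * w)
    negˡ x y z w = trans (+-cong (sym (-‿distribˡ-* x y)) (sym (-‿distribˡ-* z w)))
                         (-‿+-comm (x * y) (z * w))

    negʳ : ∀ x y z w → x * - y + z * - w ≈ - (x * y + z * w)
    negʳ x y z w = trans (+-cong (sym (-‿distribʳ-* x y)) (sym (-‿distribʳ-* z w)))
                         (-‿+-comm (x * y) (z * w))

    *ₘ-negˡ : ∀ A B → (-ₘ A) *ₘ B ≈ₘ -ₘ (A *ₘ B)
    *ₘ-negˡ (mat a b c d) (mat a′ b′ c′ d′) = mat≈
      (negˡ a a′ b c′) (negˡ a b′ b d′) (negˡ c a′ d c′) (negˡ c b′ d d′)

    *ₘ-negʳ : ∀ A B → A *ₘ (-ₘ B) ≈ₘ -ₘ (A *ₘ B)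
    *ₘ-negʳ (mat a b c d) (mat a′ b′ c′ d′) = mat≈
      (negʳ a a′ b c′) (negʳ a b′ b d′) (negʳ c a′ d c′) (negʳ c b′ d d′)

    *ₘ-assoc : ∀ A B C → (A *ₘ B) *ₘ C ≈ₘ A *ₘ (B *ₘ C)
    *ₘ-assoc (mat a b c d) (mat e f g h) (mat i j k l) = mat≈
      (entry a b i k) (entry a b j l) (entry c d i k) (entry c d j l)
      where
      entry : ∀ x y z w → (x * e + y * g) * z + (x * f + y * h) * w
                        ≈ x * (e * z + f * w) + y * (g * z + h * w)
      entry x y z w = solve 8
        (λ x y z w e f g h → (x :* e :+ y :* g) :* z :+ (x :* f :+ y :* h) :* w
          := x :* (e :* z :+ f :* w) :+ y :* (g :* z :+ h :* w)) refl x y z w e f g h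

    *ₘ-identityˡ : ∀ A → Iₘ *ₘ A ≈ₘ A
    *ₘ-identityˡ (mat a b c d) = mat≈ (l a c) (l b d) (r a c) (r b d)
      where
      l : ∀ x y → 1# * x + 0# * y ≈ x
      l = solve 2 (λ x y → con 1 :* x :+ con 0 :* y := x) refl
      r : ∀ x y → 0# * x + 1# * y ≈ y
      r = solve 2 (λ x y → con 0 :* x :+ con 1 :* y := y) refl

    *ₘ-identityʳ : ∀ A → A *ₘ Iₘ ≈ₘ A
    *ₘ-identityʳ (mat a b c d) = mat≈ (l a b) (r a b) (l c d) (r c d)
      where
      l : ∀ x y → x * 1# + y * 0# ≈ x
      l = solve 2 (λ x y → x :* con 1 :+ y :* con 0 := x) refl
      r : ∀ x y → x * 0# + y * 1# ≈ y
      r = solve 2 (λ x y → x :* con 0 :+ y :* con 1 := y) refl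

    cancel : ∀ x y → y ≈ x → x - y ≈ 0#
    cancel x y e = trans (+-cong refl (-‿cong e)) (-‿inverseʳ x)

    *-negʳ : ∀ x y → x * - y ≈ - (x * y)
    *-negʳ x y = sym (-‿distribʳ-* x y)

    *-negˡ : ∀ x y → - x * y ≈ - (x * y)
    *-negˡ x y = sym (-‿distribˡ-* x y)

    *ₘ-adjʳ : ∀ A → det A ≈ 1# → A *ₘ adj A ≈ₘ Iₘ
    *ₘ-adjʳ (mat a b c d) e = mat≈
      (trans (+-cong refl (*-negʳ b c)) e)
      (trans (+-comm _ _) (trans (+-cong refl (*-negʳ a b)) (cancel _ _ (*-comm a b))))
      (trans (+-cong refl (*-negʳ d c)) (cancel _ _ (*-comm d c)))
      (trans (+-comm _ _)
        (trans (+-cong (*-comm d a) (trans (*-negʳ c b) (-‿cong (*-comm c b)))) e))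

    *ₘ-adjˡ : ∀ A → det A ≈ 1# → adj A *ₘ A ≈ₘ Iₘ
    *ₘ-adjˡ (mat a b c d) e = mat≈
      (trans (+-cong (*-comm d a) (*-negˡ b c)) e)
      (trans (+-cong refl (*-negˡ b d)) (cancel _ _ (*-comm b d)))
      (trans (+-comm _ _) (trans (+-cong refl (*-negˡ c a)) (cancel _ _ (*-comm c a))))
      (trans (+-comm _ _) (trans (+-cong refl (trans (*-negˡ c b) (-‿cong (*-comm c b)))) e))

    det⇒ : ∀ {x y} → x - y ≈ 1# → x ≈ 1# + y
    det⇒ {x} {y} e = trans (sym (sub-add y x)) (+-cong e refl)

    det⇐ : ∀ {x y} → x ≈ 1# + y → x - y ≈ 1#
    det⇐ {x} {y} e = begin
      x - y           ≈⟨ +-cong e refl ⟩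
      1# + y - y      ≈⟨ +-assoc 1# y (- y) ⟩
      1# + (y - y)    ≈⟨ +-cong refl (-‿inverseʳ y) ⟩
      1# + 0#         ≈⟨ +-identityʳ 1# ⟩
      1#              ∎

    det-*ₘ : ∀ A B → det A ≈ 1# → det B ≈ 1# → det (A *ₘ B) ≈ 1#
    det-*ₘ (mat a b c d) (mat e f g h) p q = det⇐ (begin
      (a * e + b * g) * (c * f + d * h)
        ≈⟨ solve 8 (λ a b c d e f g h →
             (a :* e :+ b :* g) :* (c :* f :+ d :* h)
             := (a :* d) :* (e :* h) :+ (b :* c :* (f :* g) :+ (a :* f :* (c :* e) :+ b :* h :* (d :* g))))
             refl a b c d e f g h ⟩
      (a * d) * (e * h) + (b * c * (f * g) + z)
        ≈⟨ +-cong (*-cong (det⇒ p) (det⇒ q)) refl ⟩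
      (1# + b * c) * (1# + f * g) + (b * c * (f * g) + z)
        ≈⟨ solve 3 (λ u v z → (con 1 :+ u) :* (con 1 :+ v) :+ (u :* v :+ z)
             := con 1 :+ ((con 1 :+ u) :* v :+ u :* (con 1 :+ v) :+ z)) refl (b * c) (f * g) z ⟩
      1# + ((1# + b * c) * (f * g) + b * c * (1# + f * g) + z)
        ≈⟨ +-cong refl (+-cong (+-cong (*-cong (sym (det⇒ p)) refl)
                                       (*-cong refl (sym (det⇒ q)))) refl) ⟩
      1# + (a * d * (f * g) + b * c * (e * h) + z)
        ≈⟨ +-cong refl (solve 8 (λ a b c d e f g h →
             a :* d :* (f :* g) :+ b :* c :* (e :* h) :+ (a :* f :* (c :* e) :+ b :* h :* (d :* g))
             := (a :* f :+ b :* h) :* (c :* e :+ d :* g)) refl a b c d e f g h) ⟩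
      1# + (a * f + b * h) * (c * e + d * g) ∎)
      where z = a * f * (c * e) + b * h * (d * g)

    det-adj : ∀ A → det A ≈ 1# → det (adj A) ≈ 1#
    det-adj (mat a b c d) e =
      trans (+-cong (*-comm d a)
        (-‿cong (trans (*-negˡ b (- c)) (trans (-‿cong (*-negʳ b c)) (-‿involutive (b * c)))))) e

    unipotent-det : ∀ x → det (mat 1# x 0# 1#) ≈ 1#
    unipotent-det x = det⇐ (trans (*-identityˡ 1#)
      (sym (trans (+-cong refl (zeroʳ x)) (+-identityʳ 1#))))

    ≈±-refl : ∀ {A} → A ≈± A
    ≈±-refl = inj₁ ≈ₘ-refl

    ≈±-sym : ∀ {A B} → A ≈± B → B ≈± A
    ≈±-sym (inj₁ e)         = inj₁ (≈ₘ-sym e)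
    ≈±-sym {B = B} (inj₂ e) =
      inj₂ (≈ₘ-trans (≈ₘ-sym (-ₘ-involutive B)) (-ₘ-cong (≈ₘ-sym e)))

    ≈±-trans : ∀ {A B C} → A ≈± B → B ≈± C → A ≈± C
    ≈±-trans (inj₁ e) (inj₁ f)         = inj₁ (≈ₘ-trans e f)
    ≈±-trans (inj₁ e) (inj₂ f)         = inj₂ (≈ₘ-trans e f)
    ≈±-trans (inj₂ e) (inj₁ f)         = inj₂ (≈ₘ-trans e (-ₘ-cong f))
    ≈±-trans {C = C} (inj₂ e) (inj₂ f) =
      inj₁ (≈ₘ-trans e (≈ₘ-trans (-ₘ-cong f) (-ₘ-involutive C)))

    ≈±-*ₘ-cong : ∀ {A B C D} → A ≈± B → C ≈± D → A *ₘ C ≈± B *ₘ D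
    ≈±-*ₘ-cong (inj₁ e) (inj₁ f) = inj₁ (*ₘ-cong e f)
    ≈±-*ₘ-cong {B = B} {D = D} (inj₁ e) (inj₂ f) =
      inj₂ (≈ₘ-trans (*ₘ-cong e f) (*ₘ-negʳ B D))
    ≈±-*ₘ-cong {B = B} {D = D} (inj₂ e) (inj₁ f) =
      inj₂ (≈ₘ-trans (*ₘ-cong e f) (*ₘ-negˡ B D))
    ≈±-*ₘ-cong {B = B} {D = D} (inj₂ e) (inj₂ f) =
      inj₁ (≈ₘ-trans (*ₘ-cong e f) (≈ₘ-trans (*ₘ-negˡ B (-ₘ D))
             (≈ₘ-trans (-ₘ-cong (*ₘ-negʳ B D)) (-ₘ-involutive (B *ₘ D)))))

    ≈±-adj-cong : ∀ {A B} → A ≈± B → adj A ≈± adj B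
    ≈±-adj-cong (inj₁ (mat≈ p q r s)) = inj₁ (mat≈ s (-‿cong q) (-‿cong r) p)
    ≈±-adj-cong (inj₂ (mat≈ p q r s)) = inj₂ (mat≈ s (-‿cong q) (-‿cong r) p)

  PSL₂ : Group (κ ⊔ ℓ) ℓ
  PSL₂ = record
    { Carrier = SL₂
    ; _≈_     = λ A B → matrix A ≈± matrix B
    ; _∙_     = λ A B → sl (matrix A *ₘ matrix B)
                           (det-*ₘ (matrix A) (matrix B) (det≈1 A) (det≈1 B))
    ; ε       = sl Iₘ (unipotent-det 0#)
    ; _⁻¹     = λ A → sl (adj (matrix A)) (det-adj (matrix A) (det≈1 A))
    ; isGroup = record
      { isMonoid = record
        { isSemigroup = record
          { isMagma = record
            { isEquivalence = record { refl = ≈±-refl ; sym = ≈±-sym ; trans = ≈±-trans }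
            ; ∙-cong        = ≈±-*ₘ-cong
            }
          ; assoc = λ A B C → inj₁ (*ₘ-assoc (matrix A) (matrix B) (matrix C))
          }
        ; identity = (λ A → inj₁ (*ₘ-identityˡ (matrix A)))
                   , (λ A → inj₁ (*ₘ-identityʳ (matrix A)))
        }
      ; inverse = (λ A → inj₁ (*ₘ-adjˡ (matrix A) (det≈1 A)))
                , (λ A → inj₁ (*ₘ-adjʳ (matrix A) (det≈1 A)))
      ; ⁻¹-cong = ≈±-adj-cong
      }
    }
    where open SL₂

  T S : SL₂
  T = sl (mat 1# √2 0# 1#) (unipotent-det √2)
  S = sl (mat 0# (- 1#) 1# 0#)
         (det⇐ (begin
           0# * 0#              ≈⟨ zeroˡ 0# ⟩
           0#                   ≈⟨ -‿inverseʳ 1# ⟨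
           1# - 1#              ≈⟨ +-cong refl (*-identityʳ (- 1#)) ⟨
           1# + (- 1#) * 1#     ∎))

  data HeckeGenerator : Pred SL₂ (κ ⊔ ℓ) where
    translation : T ∈ HeckeGenerator
    inversion   : S ∈ HeckeGenerator

  H₄ : Pred SL₂ (κ ⊔ ℓ)
  H₄ = ⟨ PSL₂ ∣ HeckeGenerator ⟩

  -- p / q is an element of ℚ(H₄) in normalised form.  Membership in H₄ is
  -- insensitive to sign, so the column (p , q) may come from either of the two
  -- matrices representing an element; q > 0 selects one and excludes ∞.

  Normalised : Carrier → Carrier → Set (κ ⊔ ℓ)
  Normalised p q =
    (∃[ A ] A ∈ H₄ × SL₂.a A ≈ p × SL₂.c A ≈ q) × 0# < q

{-# OPTIONS --safe #-}
module Submission where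

open import Defs
open import Algebra.Bundles using (CommutativeRing)
open import Data.Nat.Base using (zero; suc)
open import Data.Product using (_×_; _,_; proj₁; proj₂; ∃-syntax)
open import Data.Sum using (_⊎_; inj₁; inj₂)
open import Level using (_⊔_; Lift; lift)
open import Relation.Binary.Bundles using (StrictTotalOrder)
open import Relation.Binary.Definitions using (tri<; tri≈; tri>)
open import Relation.Binary.Structures using (IsStrictTotalOrder)
import Relation.Binary.Construct.StrictToNonStrict as ToNonStrict
import Relation.Binary.Reasoning.StrictPartialOrder as StrictReasoning
open import Relation.Nullary.Negation using (¬_; contradiction)
open import Relation.Unary using (_∈_)

-- Farey descent in the tessellation by ideal quadrilaterals on which H₄ acts.
-- If u and v are the columns of a matrix in H₄ and α lies between the
-- fractions v ≤ u, then u, √2 u + v, √2 v + u, v are the vertices of such a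
-- quadrilateral.  As long as the new denominators stay below N, α lies between
-- two neighbours on the quadrilateral, which form a new pair whose denominators
-- have a sum larger by at least 1.  When the descent stops, α lies between two
-- fractions p / q ≥ r / s with q, s ≤ N that are either neighbours (determinant
-- δ = 1) or opposite vertices (δ = √2), and the fact that the missing
-- denominators exceed N gives 2 N δ < (q + s) (√2 + 1).  The errors
-- A = p - q α and B = s α - r of the fractions p / q and r / s satisfy
-- δ = s A + q B, so one of them is below (√2 + 1) / 2N.

-- Ordered-field arithmetic, bounds on √2 and the Archimedean property.

module OrderedField {κ ℓ} (ℝ : CompleteOrderedField κ ℓ) where

  open CompleteOrderedField ℝ
  open Hecke ℝ
  open CommutativeRing commutativeRing
    using ( refl; sym; +-cong; *-cong; +-assoc; +-comm; +-monoid
          ; +-identityˡ; +-identityʳ; *-comm; *-identityˡ; zeroˡ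
          ; -‿inverseʳ)
  open IsStrictTotalOrder isStrictTotalOrder
    using (compare; irrefl; isEquivalence; <-resp-≈)
    renaming (trans to <-trans)
  open import Algebra.Properties.Ring ring using (-‿involutive; -‿+-comm)
  open import Algebra.Properties.Monoid.Mult +-monoid public
    using () renaming (_×_ to _·_)

  strictTotalOrder : StrictTotalOrder κ ℓ ℓ
  strictTotalOrder = record { isStrictTotalOrder = isStrictTotalOrder }

  module ≤-Reasoning = StrictReasoning (StrictTotalOrder.strictPartialOrder strictTotalOrder)
  open ≤-Reasoning

  ≤-refl : ∀ {x} → x ≤ x
  ≤-refl = inj₂ refl

  ≤-trans : ∀ {x y z} → x ≤ y → y ≤ z → x ≤ z
  ≤-trans = ToNonStrict.trans _≈_ _<_ isEquivalence <-resp-≈ <-trans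

  ≤⇒≯ : ∀ {x y} → x ≤ y → ¬ (y < x)
  ≤⇒≯ (inj₁ x<y) y<x = irrefl refl (<-trans x<y y<x)
  ≤⇒≯ (inj₂ x≈y) y<x = irrefl (sym x≈y) y<x

  _≤⊎<_ : ∀ x y → x ≤ y ⊎ y < x
  x ≤⊎< y with compare x y
  ... | tri< x<y _ _ = inj₁ (inj₁ x<y)
  ... | tri≈ _ x≈y _ = inj₁ (inj₂ x≈y)
  ... | tri> _ _ y<x = inj₂ y<x

  +-monoˡ-≤ : ∀ z {x y} → x ≤ y → x + z ≤ y + z
  +-monoˡ-≤ z (inj₁ x<y) = inj₁ (+-monoˡ-< z x<y)
  +-monoˡ-≤ z (inj₂ x≈y) = inj₂ (+-cong x≈y refl)

  +-monoʳ-≤ : ∀ z {x y} → x ≤ y → z + x ≤ z + y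
  +-monoʳ-≤ z {x} {y} x≤y = begin
    z + x ≈⟨ +-comm z x ⟩
    x + z ≤⟨ +-monoˡ-≤ z x≤y ⟩
    y + z ≈⟨ +-comm y z ⟩
    z + y ∎

  +-mono-≤ : ∀ {x y u v} → x ≤ y → u ≤ v → x + u ≤ y + v
  +-mono-≤ {y = y} {u} x≤y u≤v = ≤-trans (+-monoˡ-≤ u x≤y) (+-monoʳ-≤ y u≤v)

  x≤x+y : ∀ x {y} → 0# ≤ y → x ≤ x + y
  x≤x+y x {y} 0≤y = begin
    x      ≈⟨ +-identityʳ x ⟨
    x + 0# ≤⟨ +-monoʳ-≤ x 0≤y ⟩
    x + y  ∎

  +-cancelʳ-≤ : ∀ z {x y} → x + z ≤ y + z → x ≤ y
  +-cancelʳ-≤ z {x} {y} x+z≤y+z with x ≤⊎< y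
  ... | inj₁ x≤y = x≤y
  ... | inj₂ y<x = contradiction (+-monoˡ-< z y<x) (≤⇒≯ x+z≤y+z)

  x<y+z⇒x-y<z : ∀ {x y z} → x < y + z → x - y < z
  x<y+z⇒x-y<z {x} {y} {z} x<y+z = begin-strict
    x - y       <⟨ +-monoˡ-< (- y) x<y+z ⟩
    y + z - y   ≈⟨ +-cong (+-comm y z) refl ⟩
    z + y - y   ≈⟨ +-assoc z y (- y) ⟩
    z + (y - y) ≈⟨ +-cong refl (-‿inverseʳ y) ⟩
    z + 0#      ≈⟨ +-identityʳ z ⟩
    z           ∎

  x<y⇒-y<-x : ∀ {x y} → x < y → - y < - x
  x<y⇒-y<-x {x} {y} x<y = begin-strict
    - y      ≈⟨ +-identityˡ (- y) ⟨
    0# - y   <⟨ x<y+z⇒x-y<z (sub-pos x<y) ⟩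
    - x      ∎

  *-monoˡ-≤ : ∀ {x y z} → 0# < z → x ≤ y → x * z ≤ y * z
  *-monoˡ-≤ 0<z (inj₁ x<y) = inj₁ (*-mono 0<z x<y)
  *-monoˡ-≤ 0<z (inj₂ x≈y) = inj₂ (*-cong x≈y refl)

  *-monoʳ-≤ : ∀ {x y z} → 0# < z → x ≤ y → z * x ≤ z * y
  *-monoʳ-≤ {x} {y} {z} 0<z x≤y = begin
    z * x ≈⟨ *-comm z x ⟩
    x * z ≤⟨ *-monoˡ-≤ 0<z x≤y ⟩
    y * z ≈⟨ *-comm y z ⟩
    z * y ∎

  *-nonneg : ∀ {x y} → 0# < x → 0# ≤ y → 0# ≤ x * y
  *-nonneg 0<x (inj₁ 0<y) = inj₁ (*-pos 0<x 0<y)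
  *-nonneg {x} {y} 0<x (inj₂ 0≈y) = inj₂ (begin-equality
    0#     ≈⟨ zeroˡ x ⟨
    0# * x ≈⟨ *-comm 0# x ⟩
    x * 0# ≈⟨ *-cong refl 0≈y ⟩
    x * y  ∎)

  1≤x⇒0<x : ∀ {x} → 1# ≤ x → 0# < x
  1≤x⇒0<x {x} 1≤x = begin-strict
    0# <⟨ 0<1 ⟩
    1# ≤⟨ 1≤x ⟩
    x  ∎

  ∣x-y∣<z : ∀ {x y z} → x < y + z → y < x + z → ∣ x - y ∣ < z
  ∣x-y∣<z {x} {y} {z} x<y+z y<x+z with compare (x - y) 0#
  ... | tri≈ _ _ _ = x<y+z⇒x-y<z x<y+z
  ... | tri> _ _ _ = x<y+z⇒x-y<z x<y+z
  ... | tri< _ _ _ = begin-strict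
    - (x - y)     ≈⟨ -‿+-comm x (- y) ⟨
    - x + - (- y) ≈⟨ +-cong refl (-‿involutive y) ⟩
    - x + y       ≈⟨ +-comm (- x) y ⟩
    y - x         <⟨ x<y+z⇒x-y<z y<x+z ⟩
    z             ∎

  0<√2 : 0# < √2
  0<√2 = proj₁ (proj₂ √2-exists)

  √2*√2≈2 : √2 * √2 ≈ 2#
  √2*√2≈2 = proj₂ (proj₂ √2-exists)

  1<√2 : 1# < √2
  1<√2 with √2 ≤⊎< 1#
  ... | inj₂ 1<√2 = 1<√2
  ... | inj₁ √2≤1 = contradiction 1<2 (≤⇒≯ (begin
    2#      ≈⟨ √2*√2≈2 ⟨
    √2 * √2 ≤⟨ *-monoˡ-≤ 0<√2 √2≤1 ⟩
    1# * √2 ≈⟨ *-identityˡ √2 ⟩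
    √2      ≤⟨ √2≤1 ⟩
    1#      ∎))

  -- If e is positive and z ≈ k · e lies within e of the supremum of the
  -- multiples of e that are at most x, then k + 1 works.
  archimedean : ∀ {e} → 0# < e → ∀ x → ∃[ k ] x < k · e
  archimedean {e} 0<e x with 0# ≤⊎< x
  ... | inj₂ x<0 = 0 , x<0
  ... | inj₁ 0≤x = go
    where
    sup = supremum (λ y → Lift (κ ⊔ ℓ) (y ≤ x × ∃[ k ] y ≈ k · e))
            (0# , lift (0≤x , 0 , refl)) (x , λ { _ (lift (y≤x , _)) → y≤x })
    s = proj₁ sup

    s-e<s : s - e < s
    s-e<s = x<y+z⇒x-y<z (begin-strict
      s      ≈⟨ +-identityˡ s ⟨
      0# + s <⟨ +-monoˡ-< s 0<e ⟩
      e + s  ∎)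

    go : ∃[ k ] x < k · e
    go with proj₂ (proj₂ sup) (s - e) s-e<s
    ... | z , lift (_ , k , z≈k·e) , s-e<z with (suc k · e) ≤⊎< x
    ...   | inj₂ x<[1+k]e = suc k , x<[1+k]e
    ...   | inj₁ [1+k]e≤x =
      contradiction s<[1+k]e (≤⇒≯ (proj₁ (proj₂ sup) _ (lift ([1+k]e≤x , suc k , refl))))
      where
      s<[1+k]e : s < suc k · e
      s<[1+k]e = begin-strict
        s          ≈⟨ sub-add e s ⟨
        s - e + e  <⟨ +-monoˡ-< e s-e<z ⟩
        z + e      ≈⟨ +-comm z e ⟩
        e + z      ≈⟨ +-cong refl z≈k·e ⟩
        suc k · e  ∎

-- Column vectors and the moves of H₄ on adjacent pairs.

module Farey {κ ℓ} (ℝ : CompleteOrderedField κ ℓ) where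

  open CompleteOrderedField ℝ
  open Hecke ℝ
  open OrderedField ℝ
  open CommutativeRing commutativeRing
    using ( refl; sym; trans; +-cong; *-cong; -‿cong; +-assoc; +-comm; *-comm
          ; +-identityˡ; +-identityʳ; *-identityˡ; *-identityʳ; zeroˡ; zeroʳ
          ; -‿inverseʳ)
  open import Algebra.Properties.Ring ring
    using (-‿involutive; -‿+-comm; -0#≈0#; -‿distribʳ-*)
  open import Algebra.Solver.Ring.NaturalCoefficients.Default commutativeSemiring
    using (solve; _:+_; _:*_; _:=_; con)
  open ≤-Reasoning

  -- A column vector rather than a fraction: its sign is kept, and the denominator 0 of ∞ is
  -- allowed.
  record Point : Set κ where
    constructor _∶_
    field num den : Carrier
  open Point public

  infix  4 _≋_
  infixr 6 _⊞_

  _≋_ : Point → Point → Set ℓ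
  u ≋ v = num u ≈ num v × den u ≈ den v

  -- The H₄ analogue of the mediant. It is not symmetric: u ⊞ v and v ⊞ u are the two inner vertices
  -- of the quadrilateral with outer vertices u and v.
  _⊞_ : Point → Point → Point
  u ⊞ v = (√2 * num u + num v) ∶ (√2 * den u + den v)

  -ₚ_ : Point → Point
  -ₚ u = (- num u) ∶ (- den u)

  columns : Point → Point → Mat₂
  columns u v = mat (num u) (num v) (den u) (den v)

  -- The matrix equality is exact, not up to sign, so that the signs of the denominators are fixed.
  Adjacent : Point → Point → Set (κ ⊔ ℓ)
  Adjacent u v = ∃[ A ] A ∈ H₄ × SL₂.matrix A ≈ₘ columns u v

  Adjacent-resp : ∀ {u u′ v v′} → u ≋ u′ → v ≋ v′ → Adjacent u v → Adjacent u′ v′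
  Adjacent-resp (p , q) (r , s) (A , A∈H , mat≈ a b c d) =
    A , A∈H , mat≈ (trans a p) (trans b r) (trans c q) (trans d s)

  -- A and its negative are the same element of PSL₂, so `resp` transfers membership in H₄.
  Adjacent-neg : ∀ {u v} → Adjacent u v → Adjacent (-ₚ u) (-ₚ v)
  Adjacent-neg (A@(sl (mat a b c d) e) , A∈H , mat≈ p q r s) =
    sl (-ₘ mat a b c d) det≈1 , resp (inj₂ (mat≈ (inv₂ a) (inv₂ b) (inv₂ c) (inv₂ d))) A∈H ,
    mat≈ (-‿cong p) (-‿cong q) (-‿cong r) (-‿cong s)
    where
    inv₂ : ∀ x → x ≈ - (- x)
    inv₂ x = sym (-‿involutive x)
    neg*neg : ∀ x y → - x * - y ≈ x * y
    neg*neg x y = begin-equality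
      - x * - y     ≈⟨ -‿distribʳ-* (- x) y ⟨
      - (- x * y)   ≈⟨ -‿cong (*-comm (- x) y) ⟩
      - (y * - x)   ≈⟨ -‿cong (-‿distribʳ-* y x) ⟨
      - - (y * x)   ≈⟨ -‿involutive (y * x) ⟩
      y * x         ≈⟨ *-comm y x ⟩
      x * y         ∎
    det≈1 : det (-ₘ mat a b c d) ≈ 1#
    det≈1 = trans (+-cong (neg*neg a d) (-‿cong (neg*neg b c))) e

  -- Right multiplication by `T`.
  shear : ∀ {u v} → Adjacent u v → Adjacent u (u ⊞ v)
  shear (A , A∈H , mat≈ p q r s) = _ , mul A∈H (gen translation) ,
    mat≈ (trans (fst _ _) p) (trans (snd _ _) (+-cong (*-cong refl p) q))
         (trans (fst _ _) r) (trans (snd _ _) (+-cong (*-cong refl r) s))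
    where
    fst : ∀ x y → x * 1# + y * 0# ≈ x
    fst = solve 2 (λ x y → x :* con 1 :+ y :* con 0 := x) refl
    snd : ∀ x y → x * √2 + y * 1# ≈ √2 * x + y
    snd x y = solve 3 (λ x y t → x :* t :+ y :* con 1 := t :* x :+ y) refl x y √2

  -- The second column is v - √2 u, expressed through _⊞_.
  unshear : ∀ {u v} → Adjacent u v → Adjacent u (-ₚ (u ⊞ (-ₚ v)))
  unshear (A , A∈H , mat≈ p q r s) = _ , mul A∈H (inv (gen translation)) ,
    mat≈ (trans (fst _ _) p) (snd p q) (trans (fst _ _) r) (snd r s)
    where
    fst : ∀ x y → x * 1# + y * - 0# ≈ x
    fst x y = begin-equality
      x * 1# + y * - 0# ≈⟨ +-cong refl (*-cong refl -0#≈0#) ⟩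
      x * 1# + y * 0#   ≈⟨ solve 2 (λ x y → x :* con 1 :+ y :* con 0 := x) refl x y ⟩
      x                 ∎
    snd : ∀ {x y x′ y′} → x ≈ x′ → y ≈ y′ → x * - √2 + y * 1# ≈ - (√2 * x′ + - y′)
    snd {x} {y} {x′} {y′} x≈x′ y≈y′ = begin-equality
      x * - √2 + y * 1#        ≈⟨ +-cong (-‿distribʳ-* x √2) refl ⟨
      - (x * √2) + y * 1#      ≈⟨ +-cong (-‿cong (*-comm x √2)) (*-identityʳ y) ⟩
      - (√2 * x) + y           ≈⟨ +-cong (-‿cong (*-cong refl x≈x′)) y≈y′ ⟩
      - (√2 * x′) + y′         ≈⟨ +-cong refl (-‿involutive y′) ⟨
      - (√2 * x′) + - - y′     ≈⟨ -‿+-comm (√2 * x′) (- y′) ⟩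
      - (√2 * x′ + - y′)       ∎

  -- Right multiplication by `S`.
  swap : ∀ {u v} → Adjacent u v → Adjacent v (-ₚ u)
  swap (A , A∈H , mat≈ p q r s) = _ , mul A∈H (gen inversion) ,
    mat≈ (trans (fst _ _) q) (trans (snd _ _) (-‿cong p))
         (trans (fst _ _) s) (trans (snd _ _) (-‿cong r))
    where
    fst : ∀ x y → x * 0# + y * 1# ≈ y
    fst = solve 2 (λ x y → x :* con 0 :+ y :* con 1 := y) refl
    snd : ∀ x y → x * - 1# + y * 0# ≈ - x
    snd x y = begin-equality
      x * - 1# + y * 0#   ≈⟨ +-cong (-‿distribʳ-* x 1#) (sym (zeroʳ y)) ⟨
      - (x * 1#) + 0#     ≈⟨ +-identityʳ (- (x * 1#)) ⟩
      - (x * 1#)          ≈⟨ -‿cong (*-identityʳ x) ⟩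
      - x                 ∎

  ≋-refl : ∀ {u} → u ≋ u
  ≋-refl = refl , refl

  -- Right multiplication by T S T. The second column comes out as √2 (√2 u + v) - u, which
  -- collapses to √2 v + u because √2 squares to 2.
  middle : ∀ {u v} → Adjacent u v → Adjacent (u ⊞ v) (v ⊞ u)
  middle {u} {v} adj = Adjacent-resp ≋-refl (entry (num u) (num v) , entry (den u) (den v))
                        (shear (swap (shear adj)))
    where
    entry : ∀ x y → √2 * (√2 * x + y) + - x ≈ √2 * y + x
    entry x y = begin-equality
      √2 * (√2 * x + y) + - x
        ≈⟨ solve 4 (λ t x y n → t :* (t :* x :+ y) :+ n := t :* t :* x :+ t :* y :+ n) refl √2 x y (- x) ⟩
      √2 * √2 * x + √2 * y + - x
        ≈⟨ +-cong (+-cong (*-cong √2*√2≈2 refl) refl) refl ⟩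
      2# * x + √2 * y + - x
        ≈⟨ solve 4 (λ t x y n → con 2 :* x :+ t :* y :+ n := t :* y :+ x :+ (x :+ n)) refl √2 x y (- x) ⟩
      √2 * y + x + (x - x)
        ≈⟨ trans (+-cong refl (-‿inverseʳ x)) (+-identityʳ (√2 * y + x)) ⟩
      √2 * y + x ∎

  -- Right multiplication by S T⁻¹ S, which is up to sign the lower triangular unipotent matrix with
  -- entry √2; `Adjacent-neg` removes the sign.
  lower : ∀ {u v} → Adjacent u v → Adjacent (v ⊞ u) v
  lower {u} {v} adj =
    Adjacent-resp (entry (num u) (num v) , entry (den u) (den v))
                  (-‿involutive (num v) , -‿involutive (den v))
      (Adjacent-neg (swap (unshear (swap adj))))
    where
    entry : ∀ x y → - - (√2 * y + - - x) ≈ √2 * y + x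
    entry x y = trans (-‿involutive (√2 * y + - - x)) (+-cong refl (-‿involutive x))

  -- Determinant 1 with the subtraction moved over, as the semiring solver requires.
  Adjacent⇒det : ∀ {u v} → Adjacent u v → num u * den v ≈ 1# + num v * den u
  Adjacent⇒det {p ∶ q} {r ∶ s} (sl (mat a b c d) e , _ , mat≈ a≈p b≈r c≈q d≈s) = begin-equality
    p * s                   ≈⟨ *-cong a≈p d≈s ⟨
    a * d                   ≈⟨ sub-add (b * c) (a * d) ⟨
    (a * d - b * c) + b * c ≈⟨ +-cong e (*-cong b≈r c≈q) ⟩
    1# + r * q              ∎

  Adjacent⇒Normalisedˡ : ∀ {u v} → Adjacent u v → 0# < den u → Normalised (num u) (den u)
  Adjacent⇒Normalisedˡ (A , A∈H , mat≈ p _ q _) 0<den = (A , A∈H , p , q) , 0<den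

  -- `swap` brings the second column to the front, where `Normalised` reads it.
  Adjacent⇒Normalisedʳ : ∀ {u v} → Adjacent u v → 0# < den v → Normalised (num v) (den v)
  Adjacent⇒Normalisedʳ adj = Adjacent⇒Normalisedˡ (swap adj)

  -- The target error and the two stopping configurations.

  module Approximation (α N : Carrier) (1≤N : 1# ≤ N) where

    ε : Carrier
    ε = ((√2 + 1#) / 2#) * (1# / N)

    Approximable : Set (κ ⊔ ℓ)
    Approximable = ∃[ p ] ∃[ q ]
      Normalised p q × (∣ q * α - p ∣ < ε) × (1# ≤ q) × (q ≤ N)

    0<N : 0# < N
    0<N = 1≤x⇒0<x 1≤N

    0<2N : 0# < N + N
    0<2N = +-pos 0<N 0<N

    x*x⁻¹≈1 : ∀ {x} → 0# < x → x * x ⁻¹ ≈ 1#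
    x*x⁻¹≈1 {x} 0<x = *-inverseʳ x λ x≈0 → ≤⇒≯ (inj₂ x≈0) 0<x

    -- Both inverses in `ε` are eliminated here; later estimates are multiplied through by 2N
    -- instead.
    ε*2N≈√2+1 : ε * (N + N) ≈ √2 + 1#
    ε*2N≈√2+1 = begin-equality
      ε * (N + N)
        ≈⟨ solve 4 (λ x i j n → x :* i :* (con 1 :* j) :* (n :+ n) := x :* ((con 2 :* i) :* (n :* j)))
             refl (√2 + 1#) (2# ⁻¹) (N ⁻¹) N ⟩
      (√2 + 1#) * (2# * 2# ⁻¹ * (N * N ⁻¹))
        ≈⟨ *-cong refl (*-cong (x*x⁻¹≈1 0<2) (x*x⁻¹≈1 0<N)) ⟩
      (√2 + 1#) * (1# * 1#)
        ≈⟨ solve 1 (λ x → x :* (con 1 :* con 1) := x) refl (√2 + 1#) ⟩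
      √2 + 1# ∎

    0<ε : 0# < ε
    0<ε = *-cancel 0<2N (begin-strict
      0# * (N + N) ≈⟨ zeroˡ (N + N) ⟩
      0#           <⟨ +-pos 0<√2 0<1 ⟩
      √2 + 1#      ≈⟨ ε*2N≈√2+1 ⟨
      ε * (N + N)  ∎)

    ≤⇒<+ε : ∀ {x y} → x ≤ y → x < y + ε
    ≤⇒<+ε {x} {y} x≤y = begin-strict
      x      ≤⟨ x≤y ⟩
      y      ≈⟨ +-identityˡ y ⟨
      0# + y <⟨ +-monoˡ-< y 0<ε ⟩
      ε + y  ≈⟨ +-comm ε y ⟩
      y + ε  ∎

    InRange : Carrier → Set ℓ
    InRange q = 1# ≤ q × q ≤ N

    -- The comparisons of α with the fractions, cleared of denominators.
    Above Below : Point → Set ℓ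
    Above u = den u * α ≤ num u
    Below v = num v ≤ den v * α

    -- The relation δ = s A + q B is used with the subtractions in A and B moved
    -- to the other side, which makes it a semiring identity.
    one-is-close : ∀ {u v} δ → 0# < den u → 0# < den v →
      num u * den v ≈ δ + num v * den u →
      δ * (N + N) < (den u + den v) * (√2 + 1#) →
      num u < den u * α + ε ⊎ den v * α < num v + ε
    one-is-close {p ∶ q} {r ∶ s} δ 0<q 0<s det small
      with (q * α + ε) ≤⊎< p | (r + ε) ≤⊎< (s * α)
    ... | inj₂ A<ε | _        = inj₁ A<ε
    ... | inj₁ _   | inj₂ B<ε = inj₂ B<ε
    ... | inj₁ ε≤A | inj₁ ε≤B = contradiction small (≤⇒≯ (begin
        (q + s) * (√2 + 1#)       ≈⟨ *-cong refl ε*2N≈√2+1 ⟨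
        (q + s) * (ε * (N + N))   ≈⟨ solve 3 (λ x y z → x :* (y :* z) := x :* y :* z) refl (q + s) ε (N + N) ⟩
        (q + s) * ε * (N + N)     ≤⟨ *-monoˡ-≤ 0<2N (+-cancelʳ-≤ (q * s * α + r * q) sum) ⟩
        δ * (N + N)               ∎))
      where
      sum : (q + s) * ε + (q * s * α + r * q) ≤ δ + (q * s * α + r * q)
      sum = begin
        (q + s) * ε + (q * s * α + r * q)
          ≈⟨ solve 5 (λ q s e r a → (q :+ s) :* e :+ (q :* s :* a :+ r :* q)
               := (q :* a :+ e) :* s :+ (r :+ e) :* q) refl q s ε r α ⟩
        (q * α + ε) * s + (r + ε) * q
          ≤⟨ +-mono-≤ (*-monoˡ-≤ 0<s ε≤A) (*-monoˡ-≤ 0<q ε≤B) ⟩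
        p * s + s * α * q
          ≈⟨ +-cong det refl ⟩
        δ + r * q + s * α * q
          ≈⟨ solve 5 (λ q s d r a → d :+ r :* q :+ s :* a :* q
               := d :+ (q :* s :* a :+ r :* q)) refl q s δ r α ⟩
        δ + (q * s * α + r * q) ∎

    -- The common end of all stopping cases, with δ equal to 1 or √2. The two `Normalised` proofs
    -- are separate arguments because opposite vertices, having determinant √2, are not the columns
    -- of one matrix in H₄.
    finish : ∀ {u v} δ →
      Normalised (num u) (den u) → Normalised (num v) (den v) →
      InRange (den u) → InRange (den v) → Above u → Below v →
      num u * den v ≈ δ + num v * den u →
      δ * (N + N) < (den u + den v) * (√2 + 1#) →
      Approximable
    finish {p ∶ q} {r ∶ s} δ nu nv (1≤q , q≤N) (1≤s , s≤N) above below det small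
      with one-is-close {p ∶ q} {r ∶ s} δ (1≤x⇒0<x 1≤q) (1≤x⇒0<x 1≤s) det small
    ... | inj₁ A<ε = p , q , nu , ∣x-y∣<z (≤⇒<+ε above) A<ε , 1≤q , q≤N
    ... | inj₂ B<ε = r , s , nv , ∣x-y∣<z B<ε (≤⇒<+ε below) , 1≤s , s≤N

    -- The determinant of two opposite vertices of a Farey quadrilateral is √2;
    -- x and √2 * y + x are their denominators, √2 * x + y that of the vertex
    -- between them.
    diagonal-small : ∀ {x y} → 0# < √2 * y + x → 0# < x → N < √2 * x + y →
      √2 * (N + N) < (√2 * y + x + x) * (√2 + 1#)
    diagonal-small {x} {y} 0<w′ 0<x N<w = begin-strict
      √2 * (N + N)
        ≈⟨ solve 2 (λ t n → t :* (n :+ n) := (n :+ n) :* t) refl √2 N ⟩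
      (N + N) * √2
        <⟨ *-mono 0<√2 (<-mono N<w N<w) ⟩
      (√2 * x + y + (√2 * x + y)) * √2
        ≈⟨ solve 3 (λ t x y → (t :* x :+ y :+ (t :* x :+ y)) :* t
             := (t :* y :+ t :* t :* x) :* con 2) refl √2 x y ⟩
      (√2 * y + √2 * √2 * x) * 2#
        ≈⟨ *-cong (trans (+-cong refl (*-cong √2*√2≈2 refl))
             (solve 2 (λ z x → z :+ con 2 :* x := z :+ x :+ x) refl (√2 * y) x)) refl ⟩
      (√2 * y + x + x) * 2#
        ≈⟨ *-comm (√2 * y + x + x) 2# ⟩
      2# * (√2 * y + x + x)
        <⟨ *-mono (+-pos 0<w′ 0<x) (+-monoˡ-< 1# 1<√2) ⟩
      (√2 + 1#) * (√2 * y + x + x)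
        ≈⟨ *-comm (√2 + 1#) (√2 * y + x + x) ⟩
      (√2 * y + x + x) * (√2 + 1#) ∎

    -- One step of the descent.

    record Bracket (u v : Point) : Set (κ ⊔ ℓ) where
      constructor bracket
      field
        adjacent : Adjacent u v
        rangeˡ   : InRange (den u)
        rangeʳ   : InRange (den v)
        above    : Above u
        below    : Below v

    -- Only 0 ≤ x is asked, so that x may be the denominator of `∞`.
    1≤√2*x+y : ∀ {x y} → 0# ≤ x → 1# ≤ y → 1# ≤ √2 * x + y
    1≤√2*x+y {x} {y} 0≤x 1≤y = begin
      1#         ≤⟨ 1≤y ⟩
      y          ≤⟨ x≤x+y y (*-nonneg 0<√2 0≤x) ⟩
      y + √2 * x ≈⟨ +-comm y (√2 * x) ⟩
      √2 * x + y ∎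

    1≤√2*x : ∀ {x} → 1# ≤ x → 1# ≤ √2 * x
    1≤√2*x {x} 1≤x = begin
      1#      ≤⟨ inj₁ 1<√2 ⟩
      √2      ≈⟨ *-identityʳ √2 ⟨
      √2 * 1# ≤⟨ *-monoʳ-≤ 0<√2 1≤x ⟩
      √2 * x  ∎

    1≤√2*y+x : ∀ {x y} → 0# ≤ x → 1# ≤ y → 1# ≤ √2 * y + x
    1≤√2*y+x {x} {y} 0≤x 1≤y = ≤-trans (1≤√2*x 1≤y) (x≤x+y (√2 * y) 0≤x)

    -- Passing the rest of the descent as an argument keeps the case analysis free of recursion, so
    -- that `search` and `locate` can share `refine-below`. The growth by 1 is what makes `search`
    -- terminate.
    Continuation : Point → Point → Set (κ ⊔ ℓ)
    Continuation u v = ∀ {u′ v′} → Bracket u′ v′ →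
      1# + (den u + den v) ≤ den u′ + den v′ → Approximable

    -- In each of the three moves the new sum contains q + s together with √2 times an old
    -- denominator that is at least 1.
    lower-growth : ∀ {q s} → 1# ≤ s → 1# + (q + s) ≤ √2 * s + q + s
    lower-growth {q} {s} 1≤s = begin
      1# + (q + s)         ≤⟨ +-monoˡ-≤ (q + s) (1≤√2*x 1≤s) ⟩
      √2 * s + (q + s)     ≈⟨ +-assoc (√2 * s) q s ⟨
      √2 * s + q + s       ∎

    middle-growth : ∀ {q s} → 0# ≤ q → 1# ≤ s → 1# + (q + s) ≤ √2 * q + s + (√2 * s + q)
    middle-growth {q} {s} 0≤q 1≤s = begin
      1# + (q + s)                  ≤⟨ lower-growth 1≤s ⟩
      √2 * s + q + s                ≤⟨ x≤x+y (√2 * s + q + s) (*-nonneg 0<√2 0≤q) ⟩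
      √2 * s + q + s + √2 * q       ≈⟨ solve 4 (λ a b q s → a :+ q :+ s :+ b := b :+ s :+ (a :+ q))
                                         refl (√2 * s) (√2 * q) q s ⟩
      √2 * q + s + (√2 * s + q)     ∎

    upper-growth : ∀ {q s} → 1# ≤ q → 1# + (q + s) ≤ q + (√2 * q + s)
    upper-growth {q} {s} 1≤q = begin
      1# + (q + s)       ≤⟨ +-monoˡ-≤ (q + s) (1≤√2*x 1≤q) ⟩
      √2 * q + (q + s)   ≈⟨ solve 3 (λ a q s → a :+ (q :+ s) := q :+ (a :+ s)) refl (√2 * q) q s ⟩
      q + (√2 * q + s)   ∎

    -- The part of a step after α ≤ u ⊞ v is known. The vertex u itself is no longer an endpoint, so
    -- its denominator need only be nonnegative, and u may be `∞`.
    refine-below : ∀ {u v} → Adjacent u v → 0# ≤ den u → InRange (den v) →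
      den (u ⊞ v) ≤ N → Above (u ⊞ v) → Below v → Continuation u v → Approximable
    refine-below {u@(p ∶ q)} {v@(r ∶ s)} adj 0≤q (1≤s , s≤N) w₁≤N above below k
      with den (v ⊞ u) ≤⊎< N
    -- The missing vertex v ⊞ u separates the opposite vertices u ⊞ v and v.
    ... | inj₂ N<w₂ = finish {u ⊞ v} {v} √2
        (Adjacent⇒Normalisedˡ (middle adj) 0<w₁)
        (Adjacent⇒Normalisedʳ adj (1≤x⇒0<x 1≤s))
        (1≤√2*x+y 0≤q 1≤s , w₁≤N) (1≤s , s≤N) above below diagonal
        (diagonal-small 0<w₁ (1≤x⇒0<x 1≤s) N<w₂)
      where
      0<w₁ : 0# < √2 * q + s
      0<w₁ = 1≤x⇒0<x (1≤√2*x+y 0≤q 1≤s)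
      diagonal : (√2 * p + r) * s ≈ √2 + r * (√2 * q + s)
      diagonal = begin-equality
        (√2 * p + r) * s
          ≈⟨ solve 4 (λ t p r s → (t :* p :+ r) :* s := t :* (p :* s) :+ r :* s) refl √2 p r s ⟩
        √2 * (p * s) + r * s
          ≈⟨ +-cong (*-cong refl (Adjacent⇒det {u} {v} adj)) refl ⟩
        √2 * (1# + r * q) + r * s
          ≈⟨ solve 4 (λ t q r s → t :* (con 1 :+ r :* q) :+ r :* s
               := t :+ r :* (t :* q :+ s)) refl √2 q r s ⟩
        √2 + r * (√2 * q + s) ∎
    ... | inj₁ w₂≤N with (den (v ⊞ u) * α) ≤⊎< num (v ⊞ u)
    ...   | inj₁ above₂ =
      k (bracket (lower adj) (1≤√2*y+x 0≤q 1≤s , w₂≤N) (1≤s , s≤N) above₂ below) (lower-growth 1≤s)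
    ...   | inj₂ below₂ =
      k (bracket (middle adj) (1≤√2*x+y 0≤q 1≤s , w₁≤N) (1≤√2*y+x 0≤q 1≤s , w₂≤N) above (inj₁ below₂))
        (middle-growth 0≤q 1≤s)

    refine : ∀ {u v} → Bracket u v → Continuation u v → Approximable
    refine {u@(p ∶ q)} {v@(r ∶ s)} (bracket adj (1≤q , q≤N) (1≤s , s≤N) above below) k
      with den (u ⊞ v) ≤⊎< N | den (v ⊞ u) ≤⊎< N
    ... | inj₁ w₁≤N | _ with (den (u ⊞ v) * α) ≤⊎< num (u ⊞ v)
    ...   | inj₁ above₁ =
      refine-below adj (inj₁ (1≤x⇒0<x 1≤q)) (1≤s , s≤N) w₁≤N above₁ below k
    ...   | inj₂ below₁ =
      k (bracket (shear adj) (1≤q , q≤N) (1≤√2*x+y (inj₁ (1≤x⇒0<x 1≤q)) 1≤s , w₁≤N) above (inj₁ below₁))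
        (upper-growth 1≤q)
    -- Neither inner vertex fits: the outer neighbours have δ = 1, and the two inner denominators
    -- add up to exactly (q + s) (√2 + 1).
    refine {u@(p ∶ q)} {v@(r ∶ s)} (bracket adj (1≤q , q≤N) (1≤s , s≤N) above below) k
        | inj₂ N<w₁ | inj₂ N<w₂ = finish {u} {v} 1#
      (Adjacent⇒Normalisedˡ adj (1≤x⇒0<x 1≤q)) (Adjacent⇒Normalisedʳ adj (1≤x⇒0<x 1≤s))
      (1≤q , q≤N) (1≤s , s≤N) above below (Adjacent⇒det {u} {v} adj) (begin-strict
        1# * (N + N)                   ≈⟨ *-identityˡ (N + N) ⟩
        N + N                          <⟨ <-mono N<w₁ N<w₂ ⟩
        √2 * q + s + (√2 * s + q)      ≈⟨ solve 3 (λ t q s → t :* q :+ s :+ (t :* s :+ q)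
                                            := (q :+ s) :* (t :+ con 1)) refl √2 q s ⟩
        (q + s) * (√2 + 1#)            ∎)
    refine {u@(p ∶ q)} {v@(r ∶ s)} (bracket adj (1≤q , q≤N) (1≤s , s≤N) above below) k
        | inj₂ N<w₁ | inj₁ w₂≤N with (den (v ⊞ u) * α) ≤⊎< num (v ⊞ u)
    ...   | inj₁ above₂ =
      k (bracket (lower adj) (1≤√2*x+y (inj₁ (1≤x⇒0<x 1≤s)) 1≤q , w₂≤N) (1≤s , s≤N) above₂ below)
        (lower-growth 1≤s)
    -- Here α lies between the opposite vertices v ⊞ u and u, and u ⊞ v is the missing vertex
    -- between them.
    ...   | inj₂ below₂ = finish {u} {v ⊞ u} √2
      (Adjacent⇒Normalisedˡ adj (1≤x⇒0<x 1≤q))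
      (Adjacent⇒Normalisedˡ (lower adj) 0<w₂)
      (1≤q , q≤N) (1≤w₂ , w₂≤N) above (inj₁ below₂) diagonal (begin-strict
        √2 * (N + N)                       <⟨ diagonal-small 0<w₂ (1≤x⇒0<x 1≤q) N<w₁ ⟩
        (√2 * s + q + q) * (√2 + 1#)       ≈⟨ *-cong (+-comm (√2 * s + q) q) refl ⟩
        (q + (√2 * s + q)) * (√2 + 1#)     ∎)
      where
      1≤w₂ : 1# ≤ √2 * s + q
      1≤w₂ = 1≤√2*x+y (inj₁ (1≤x⇒0<x 1≤s)) 1≤q
      0<w₂ : 0# < √2 * s + q
      0<w₂ = 1≤x⇒0<x 1≤w₂
      diagonal : p * (√2 * s + q) ≈ √2 + (√2 * r + p) * q
      diagonal = begin-equality
        p * (√2 * s + q)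
          ≈⟨ solve 4 (λ t p q s → p :* (t :* s :+ q) := t :* (p :* s) :+ p :* q) refl √2 p q s ⟩
        √2 * (p * s) + p * q
          ≈⟨ +-cong (*-cong refl (Adjacent⇒det {u} {v} adj)) refl ⟩
        √2 * (1# + r * q) + p * q
          ≈⟨ solve 4 (λ t p q r → t :* (con 1 :+ r :* q) :+ p :* q
               := t :+ (t :* r :+ p) :* q) refl √2 p q r ⟩
        √2 + (√2 * r + p) * q ∎

    -- The number k is fuel: every step raises the sum of the denominators by at least 1, so k - 1
    -- suffices for the next bracket. At k = 0 the sum would exceed 2N although both denominators
    -- are at most N.
    search : ∀ k {u v} → Bracket u v → N + N < den u + den v + k · 1# → Approximable
    search zero {u} {v} b 2N<q+s = contradiction 2N<q+s (≤⇒≯ (begin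
      den u + den v + 0# ≈⟨ +-identityʳ (den u + den v) ⟩
      den u + den v      ≤⟨ +-mono-≤ (proj₂ (Bracket.rangeˡ b)) (proj₂ (Bracket.rangeʳ b)) ⟩
      N + N              ∎))
    search (suc k) {u} {v} b fuel = refine b λ {u′} {v′} b′ growth → search k b′ (begin-strict
      N + N                            <⟨ fuel ⟩
      den u + den v + (1# + k · 1#)    ≈⟨ solve 2 (λ x y → x :+ (con 1 :+ y) := con 1 :+ x :+ y)
                                            refl (den u + den v) (k · 1#) ⟩
      1# + (den u + den v) + k · 1#    ≤⟨ +-monoˡ-≤ (k · 1#) growth ⟩
      den u′ + den v′ + k · 1#         ∎)

    -- The first bracket, found next to ∞.

    ∞ : Point
    ∞ = 1# ∶ 0#

    -- The matrices are the powers of T⁻¹.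
    translate-left : ∀ k → Adjacent ∞ ((- (k · √2)) ∶ 1#)
    translate-left zero = _ , unit , mat≈ refl (sym -0#≈0#) refl refl
    translate-left (suc k) = Adjacent-resp ≋-refl (numerator , denominator) (unshear (translate-left k))
      where
      numerator : - (√2 * 1# + - - (k · √2)) ≈ - (√2 + k · √2)
      numerator = -‿cong (+-cong (*-identityʳ √2) (-‿involutive (k · √2)))
      denominator : - (√2 * 0# + - 1#) ≈ 1#
      denominator = trans (-‿cong (trans (+-cong (zeroʳ √2) refl) (+-identityˡ (- 1#)))) (-‿involutive 1#)

    √2*0+y≈1 : ∀ {y} → y ≈ 1# → √2 * 0# + y ≈ 1#
    √2*0+y≈1 y≈1 = trans (+-cong (zeroʳ √2) y≈1) (+-identityˡ 1#)

    -- Walks to the right in steps of √2 along the neighbours of `∞` until α lies between two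
    -- consecutive ones; k bounds the remaining steps. The denominator is 1 only up to `≈`, since
    -- each `shear` rewrites it as √2 · 0 + s.
    locate : ∀ k {v} → Adjacent ∞ v → den v ≈ 1# → Below v → α < num v + k · √2 → Approximable
    locate zero {r ∶ s} _ s≈1 below α<r = contradiction α<r (≤⇒≯ (begin
      r + 0#   ≈⟨ +-identityʳ r ⟩
      r        ≤⟨ below ⟩
      s * α    ≈⟨ *-cong s≈1 refl ⟩
      1# * α   ≈⟨ *-identityˡ α ⟩
      α        ∎))
    locate (suc k) {v@(r ∶ s)} adj s≈1 below α<r+[1+k]√2
      with (den (∞ ⊞ v) * α) ≤⊎< num (∞ ⊞ v)
    ... | inj₂ below₁ = locate k (shear adj) (√2*0+y≈1 s≈1) (inj₁ below₁) (begin-strict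
        α                           <⟨ α<r+[1+k]√2 ⟩
        r + (√2 + k · √2)           ≈⟨ solve 3 (λ r t z → r :+ (t :+ z) := t :* con 1 :+ r :+ z)
                                         refl r √2 (k · √2) ⟩
        √2 * 1# + r + k · √2        ∎)
    -- Now α lies between v and ∞ ⊞ v, opposite vertices of a quadrilateral with vertex `∞`. As
    -- denominators in a bracket are positive, any n above 2N is enough fuel for `search`.
    ... | inj₁ above₁ =
      refine-below adj ≤-refl (inj₂ (sym s≈1) , ≈1⇒≤N s≈1) (≈1⇒≤N (√2*0+y≈1 s≈1)) above₁ below
        λ {u′} {v′} b _ → let n , 2N<n = archimedean 0<1 (N + N) in search n b (begin-strict
          N + N                       <⟨ 2N<n ⟩
          n · 1#                      ≤⟨ x≤x+y (n · 1#) (inj₁ (+-pos (1≤x⇒0<x (proj₁ (Bracket.rangeˡ b)))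
                                                                  (1≤x⇒0<x (proj₁ (Bracket.rangeʳ b))))) ⟩
          n · 1# + (den u′ + den v′)  ≈⟨ +-comm (n · 1#) (den u′ + den v′) ⟩
          den u′ + den v′ + n · 1#    ∎)
      where
      ≈1⇒≤N : ∀ {x} → x ≈ 1# → x ≤ N
      ≈1⇒≤N x≈1 = ≤-trans (inj₂ x≈1) 1≤N

    approximable : Approximable
    -- The first multiple of √2 puts the start of the walk to the left of α, the second bounds its
    -- length.
    approximable with archimedean 0<√2 (- α)
    ... | n , -α<n√2 with archimedean 0<√2 (α + n · √2)
    ...   | k , α+n√2<k√2 = locate k (translate-left n) refl
      (inj₁ (begin-strict
        - (n · √2)  <⟨ x<y⇒-y<-x -α<n√2 ⟩
        - - α       ≈⟨ -‿involutive α ⟩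
        α           ≈⟨ *-identityˡ α ⟨
        1# * α      ∎))
      (begin-strict
        α                                ≈⟨ trans (+-cong refl (-‿inverseʳ (n · √2))) (+-identityʳ α) ⟨
        α + (n · √2 - n · √2)            ≈⟨ +-assoc α (n · √2) (- (n · √2)) ⟨
        α + n · √2 - n · √2              <⟨ +-monoˡ-< (- (n · √2)) α+n√2<k√2 ⟩
        k · √2 - n · √2                  ≈⟨ +-comm (k · √2) (- (n · √2)) ⟩
        - (n · √2) + k · √2              ∎)

theorem1p1 : ∀ {c ℓ} (ℝ : CompleteOrderedField c ℓ) →
    let open CompleteOrderedField ℝ
        open Hecke ℝ
    in
    (α : Carrier) (N : Carrier) → 1# ≤ N →
    ∃[ p ] ∃[ q ]
      Normalised p q ×
      (∣ q * α - p ∣ < ((√2 + 1#) / 2#) * (1# / N)) ×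
      (1# ≤ q) × (q ≤ N)
theorem1p1 ℝ α N 1≤N = Farey.Approximation.approximable ℝ α N 1≤N
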